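{- For every integer $k\ge1$, $N(2k+4,k)=2$ if $3\mid k$ and $N(2k+4,k)=0$ if $3\nmid k$.
   Context: For $n>k\ge1$, $N(n,k)$ is the nullity of the $n\times n$ skew-symmetric Toeplitz matrix $A(n,k)$ whose first $k$ superdiagonals have all entries $1$ and whose remaining superdiagonals have all entries $0$. -}

module Defs where

open import Data.Bool using (if_then_else_)
open import Data.Fin using (Fin; toℕ)
open import Data.Nat using (ℕ; _∸_; _≤?_)
open import Data.Nat.Properties using (<-cmp)
open import Data.Product using (∃-syntax)
open import Data.Rational using (ℚ; 0ℚ; 1ℚ; -_; _*_)
open import Data.Rational.Properties using (+-0-monoid)
open import Data.Vec.Functional using (Vector)
open import Relation.Binary using (tri<; tri≈; tri>)
open import Relation.Binary.PropositionalEquality using (_≗_)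
open import Relation.Nullary.Decidable using (⌊_⌋)

open import Algebra.Properties.Monoid.Sum +-0-monoid using (sum-syntax)

Matrix : ℕ → ℕ → Set
Matrix m n = Fin m → Fin n → ℚ

_·_ : ∀ {m n} → Matrix m n → Vector ℚ n → Vector ℚ m
_·_ {n = n} M v i = ∑[ j < n ] (M i j * v j)

𝟎 : ∀ {n} → Vector ℚ n
𝟎 _ = 0ℚ

-- Vectors are functions, so they are compared pointwise (_≗_).

InKernel : ∀ {m n} → Matrix m n → Vector ℚ n → Set
InKernel M v = M · v ≗ 𝟎

linComb : ∀ {d n} → Vector ℚ d → (Fin d → Vector ℚ n) → Vector ℚ n
linComb {d} c b j = ∑[ i < d ] (c i * b i j)

LinearlyIndependent : ∀ {d n} → (Fin d → Vector ℚ n) → Set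
LinearlyIndependent b = ∀ c → linComb c b ≗ 𝟎 → c ≗ 𝟎

record IsKernelBasis {m n d} (M : Matrix m n) (b : Fin d → Vector ℚ n) : Set where
  field
    inKernel    : ∀ i → InKernel M (b i)
    independent : LinearlyIndependent b
    spanning    : ∀ v → InKernel M v → ∃[ c ] (v ≗ linComb c b)

-- The nullity of M, i.e. the dimension of its kernel, equals d.
HasNullity : ∀ {m n} → Matrix m n → ℕ → Set
HasNullity {n = n} M d = ∃[ b ] IsKernelBasis {n = n} {d = d} M b

-- c d is the common value on the d-th superdiagonal (j - i = d ≥ 1); c 0 is unused.
skewToeplitz : ∀ n → (ℕ → ℚ) → Matrix n n
skewToeplitz n c i j with <-cmp (toℕ i) (toℕ j)
... | tri< _ _ _ = c (toℕ j ∸ toℕ i)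
... | tri≈ _ _ _ = 0ℚ
... | tri> _ _ _ = - c (toℕ i ∸ toℕ j)

A : ∀ n → ℕ → Matrix n n
A n k = skewToeplitz n (λ d → if ⌊ d ≤? k ⌋ then 1ℚ else 0ℚ)

-- N⟨ n , k ⟩≡ d  reads  N(n,k) = d  (meaningful for n > k ≥ 1).
N⟨_,_⟩≡_ : ℕ → ℕ → ℕ → Set
N⟨ n , k ⟩≡ d = HasNullity (A n k) d

{-# OPTIONS --safe #-}

-- In terms of the prefix sums f m = v 0 + … + v (m − 1), the kernel equations of
-- A(n,k) read f (i + k + 1) + f (i − k) = f (i + 1) + f i, where f vanishes up to 0
-- and is constant from n on. For n = 2k + 4 put a = f 2 and t = f n. The first k + 1
-- equations express f (k + 1 + i) through f 0 … f (k + 1); the remaining ones then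
-- give f 1 = 0, f j + f (j + 1) + f (j + 2) = t for 1 ≤ j < k, f (k + 1) = 0 and
-- t = a + f k. So f runs through 0, a, t − a periodically on 1 … k + 1, and the last
-- two conditions hold for all a and t if 3 ∣ k, but force a = t = 0 otherwise.

module Submission where

open import Defs
open import Data.Nat using (ℕ; _+_; _*_; _≤_)
open import Data.Nat.Divisibility using (_∣_; _∤_)
open import Data.Product using (_×_)

open import Data.Bool using (if_then_else_)
open import Data.Fin using (Fin; zero; suc; toℕ; fromℕ<)
open import Data.Fin.Properties using (toℕ<n; toℕ-fromℕ<)
open import Data.Nat using (zero; suc; _∸_; _<_; _<ᵇ_; _≤?_; z≤n; s≤s)
open import Data.Nat.Divisibility using (divides; ∣m∣n⇒∣m+n; ∣-refl)
open import Data.Nat.Properties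
open import Data.Nat.Tactic.RingSolver using () renaming (solve-∀ to ℕ-solve-∀)
open import Data.Product using (_,_; proj₁; proj₂)
open import Data.Rational as ℚ using (ℚ; 0ℚ; 1ℚ)
import Data.Rational.Properties as ℚ
open import Data.Sum using (inj₁; inj₂)
open import Data.Vec.Functional using (Vector)
open import Function using (_∘_)
open import Level using (0ℓ)
open import Relation.Binary using (tri<; tri≈; tri>)
open import Relation.Binary.PropositionalEquality using (_≡_; _≗_; refl; sym; trans; cong; cong₂; subst; module ≡-Reasoning)
open import Relation.Nullary using (yes; no; contradiction)
open import Relation.Nullary.Decidable using (dec⇒maybe; ⌊_⌋)
open import Tactic.RingSolver using (solve-∀)
open import Tactic.RingSolver.Core.AlmostCommutativeRing using (AlmostCommutativeRing; fromCommutativeRing)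

open import Algebra.Properties.Monoid.Sum ℚ.+-0-monoid using (sum-syntax; sum-cong-≗)
open import Algebra.Properties.Group ℚ.+-0-group using (∙-cancelˡ; ∙-cancelʳ; identityʳ-unique; x∙y⁻¹≈ε⇒x≈y; x≈y⇒x∙y⁻¹≈ε)

open ≡-Reasoning

ℚ-ring : AlmostCommutativeRing 0ℓ 0ℓ
ℚ-ring = fromCommutativeRing ℚ.+-*-commutativeRing (λ x → dec⇒maybe (0ℚ ℚ.≟ x))

-- Prefix sums

-- The sum saturates past the end of the vector, so a band that sticks out of the matrix on the
-- right needs no case distinction.
prefix : ∀ {n} → Vector ℚ n → ℕ → ℚ
prefix {zero}  v m       = 0ℚ
prefix {suc n} v zero    = 0ℚ
prefix {suc n} v (suc m) = v zero ℚ.+ prefix (v ∘ suc) m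

difference : ∀ {n} → (ℕ → ℚ) → Vector ℚ n
difference f j = f (suc (toℕ j)) ℚ.- f (toℕ j)

prefix-zero : ∀ {n} (v : Vector ℚ n) → prefix v 0 ≡ 0ℚ
prefix-zero {zero}  v = refl
prefix-zero {suc n} v = refl

prefix-≥ : ∀ {n} (v : Vector ℚ n) m → n ≤ m → prefix v m ≡ prefix v n
prefix-≥ {zero}  v m       _         = refl
prefix-≥ {suc n} v (suc m) (s≤s n≤m) = cong (v zero ℚ.+_) (prefix-≥ (v ∘ suc) m n≤m)

prefix-𝟎 : ∀ {n} {v : Vector ℚ n} → v ≗ 𝟎 → ∀ m → prefix v m ≡ 0ℚ
prefix-𝟎 {zero}  v≗𝟎 m       = refl
prefix-𝟎 {suc n} v≗𝟎 zero    = refl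
prefix-𝟎 {suc n} v≗𝟎 (suc m) = cong₂ ℚ._+_ (v≗𝟎 zero) (prefix-𝟎 (v≗𝟎 ∘ suc) m)

difference-prefix : ∀ {n} (v : Vector ℚ n) → difference (prefix v) ≗ v
difference-prefix {suc n} v zero = begin
  (v zero ℚ.+ prefix (v ∘ suc) 0) ℚ.- 0ℚ ≡⟨ cong (λ x → (v zero ℚ.+ x) ℚ.- 0ℚ) (prefix-zero (v ∘ suc)) ⟩
  (v zero ℚ.+ 0ℚ) ℚ.- 0ℚ                 ≡⟨ identity (v zero) ⟩
  v zero                                 ∎
  where
  identity : ∀ x → (x ℚ.+ 0ℚ) ℚ.- 0ℚ ≡ x
  identity = solve-∀ ℚ-ring
difference-prefix {suc n} v (suc j) =
  trans (identity (v zero) _ _) (difference-prefix (v ∘ suc) j)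
  where
  identity : ∀ x y z → (x ℚ.+ y) ℚ.- (x ℚ.+ z) ≡ y ℚ.- z
  identity = solve-∀ ℚ-ring

prefix-difference : ∀ {n} f m → m ≤ n → prefix (difference {n} f) m ≡ f m ℚ.- f 0
prefix-difference {zero}  f zero    _         = sym (ℚ.+-inverseʳ (f 0))
prefix-difference {suc n} f zero    _         = sym (ℚ.+-inverseʳ (f 0))
prefix-difference {suc n} f (suc m) (s≤s m≤n) =
  trans (cong (f 1 ℚ.- f 0 ℚ.+_) (prefix-difference (f ∘ suc) m m≤n))
        (identity (f 0) (f 1) (f (suc m)))
  where
  identity : ∀ x y z → (y ℚ.- x) ℚ.+ (z ℚ.- y) ≡ z ℚ.- x
  identity = solve-∀ ℚ-ring

-- Rows of the matrix as combinations of prefix sums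

[_<_] : ℕ → ℕ → ℚ
[ j < m ] = if j <ᵇ m then 1ℚ else 0ℚ

[<]-yes : ∀ {j m} → j < m → [ j < m ] ≡ 1ℚ
[<]-yes {zero}  {suc m} _         = refl
[<]-yes {suc j} {suc m} (s≤s j<m) = [<]-yes j<m

[<]-no : ∀ {j m} → m ≤ j → [ j < m ] ≡ 0ℚ
[<]-no {j}     {zero}  _         = refl
[<]-no {suc j} {suc m} (s≤s m≤j) = [<]-no m≤j

∑-zero : ∀ n (v : Vector ℚ n) → ∑[ j < n ] (0ℚ ℚ.* v j) ≡ 0ℚ
∑-zero zero    v = refl
∑-zero (suc n) v = cong₂ ℚ._+_ (ℚ.*-zeroˡ (v zero)) (∑-zero n (v ∘ suc))

prefix-∑ : ∀ n (v : Vector ℚ n) m → ∑[ j < n ] ([ toℕ j < m ] ℚ.* v j) ≡ prefix v m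
prefix-∑ zero    v m       = refl
prefix-∑ (suc n) v zero    = ∑-zero (suc n) v
prefix-∑ (suc n) v (suc m) = cong₂ ℚ._+_ (ℚ.*-identityˡ (v zero)) (prefix-∑ n (v ∘ suc) m)

∑-combine : ∀ n (a b c d v : Vector ℚ n) →
  ∑[ j < n ] (((a j ℚ.+ b j) ℚ.- (c j ℚ.+ d j)) ℚ.* v j) ≡
  (∑[ j < n ] (a j ℚ.* v j) ℚ.+ ∑[ j < n ] (b j ℚ.* v j)) ℚ.-
  (∑[ j < n ] (c j ℚ.* v j) ℚ.+ ∑[ j < n ] (d j ℚ.* v j))
∑-combine zero    a b c d v = refl
∑-combine (suc n) a b c d v =
  trans (cong (((a zero ℚ.+ b zero) ℚ.- (c zero ℚ.+ d zero)) ℚ.* v zero ℚ.+_)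
              (∑-combine n (a ∘ suc) (b ∘ suc) (c ∘ suc) (d ∘ suc) (v ∘ suc)))
        (identity (a zero) (b zero) (c zero) (d zero) (v zero) _ _ _ _)
  where
  identity : ∀ a b c d v p q r s →
    ((a ℚ.+ b) ℚ.- (c ℚ.+ d)) ℚ.* v ℚ.+ ((p ℚ.+ q) ℚ.- (r ℚ.+ s)) ≡
    ((a ℚ.* v ℚ.+ p) ℚ.+ (b ℚ.* v ℚ.+ q)) ℚ.- ((c ℚ.* v ℚ.+ r) ℚ.+ (d ℚ.* v ℚ.+ s))
  identity = solve-∀ ℚ-ring

-- Row `i` is 1 on the columns from i + 1 to i + k and -1 on those from i - k to i - 1. Each stretch
-- is a difference of two initial segments, and the terms are grouped by sign. For `i ≤ k` the
-- truncated `i ∸ k` is 0 and gives the empty segment.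
windowEntry : ℕ → ℕ → ℕ → ℚ
windowEntry k i j = ([ j < suc i + k ] ℚ.+ [ j < i ∸ k ]) ℚ.- ([ j < suc i ] ℚ.+ [ j < i ])

band : ℕ → ℕ → ℚ
band k d = if ⌊ d ≤? k ⌋ then 1ℚ else 0ℚ

windowEntry-above : ∀ k {i j} → i < j → band k (j ∸ i) ≡ windowEntry k i j
windowEntry-above k {i} {j} i<j
  rewrite [<]-no {j} {i ∸ k} (≤-trans (m∸n≤m i k) (<⇒≤ i<j)) | [<]-no i<j | [<]-no (<⇒≤ i<j)
  with j ∸ i ≤? k
... | yes j∸i≤k
  rewrite [<]-yes {j} {suc i + k} (s≤s (≤-trans (m≤n+m∸n j i) (+-monoʳ-≤ i j∸i≤k))) = refl
... | no  j∸i≰k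
  rewrite [<]-no {j} {suc i + k} (subst (_≤ j) (cong suc (+-comm k i))
            (m≤o∸n⇒m+n≤o (suc k) (<⇒≤ i<j) (≰⇒> j∸i≰k))) = refl

windowEntry-diagonal : ∀ k i → 0ℚ ≡ windowEntry k i i
windowEntry-diagonal k i
  rewrite [<]-no {i} {i ∸ k} (m∸n≤m i k) | [<]-yes (n<1+n i) | [<]-no (≤-refl {i})
        | [<]-yes {i} {suc i + k} (m≤m+n (suc i) k) = refl

windowEntry-below : ∀ k {i j} → j < i → ℚ.- band k (i ∸ j) ≡ windowEntry k i j
windowEntry-below k {i} {j} j<i
  rewrite [<]-yes j<i | [<]-yes (m<n⇒m<1+n j<i)
        | [<]-yes {j} {suc i + k} (≤-trans (m<n⇒m<1+n j<i) (m≤m+n (suc i) k))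
  with i ∸ j ≤? k
... | yes i∸j≤k
  rewrite [<]-no {j} {i ∸ k} (m≤n+o⇒m∸n≤o i k (subst (i ≤_) (+-comm j k)
            (≤-trans (m≤n+m∸n i j) (+-monoʳ-≤ j i∸j≤k)))) = refl
... | no  i∸j≰k
  rewrite [<]-yes {j} {i ∸ k} (m+n≤o⇒m≤o∸n (suc j) (subst (_≤ i) (cong suc (+-comm k j))
            (m≤o∸n⇒m+n≤o (suc k) (<⇒≤ j<i) (≰⇒> i∸j≰k)))) = refl

A-entry : ∀ n k (i j : Fin n) → A n k i j ≡ windowEntry k (toℕ i) (toℕ j)
A-entry n k i j with <-cmp (toℕ i) (toℕ j)
... | tri< i<j _ _ = windowEntry-above k i<j
... | tri≈ _ i≡j _ = trans (windowEntry-diagonal k (toℕ i)) (cong (windowEntry k (toℕ i)) i≡j)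
... | tri> _ _ j<i = windowEntry-below k j<i

A-row : ∀ n k (v : Vector ℚ n) (i : Fin n) →
  (A n k · v) i ≡ (prefix v (suc (toℕ i) + k) ℚ.+ prefix v (toℕ i ∸ k)) ℚ.-
                  (prefix v (suc (toℕ i)) ℚ.+ prefix v (toℕ i))
A-row n k v i = begin
  (A n k · v) i
    ≡⟨ sum-cong-≗ (λ j → cong (ℚ._* v j) (A-entry n k i j)) ⟩
  ∑[ j < n ] (windowEntry k (toℕ i) (toℕ j) ℚ.* v j)
    ≡⟨ ∑-combine n (below (suc (toℕ i) + k)) (below (toℕ i ∸ k)) (below (suc (toℕ i))) (below (toℕ i)) v ⟩
  _
    ≡⟨ cong₂ ℚ._-_ (cong₂ ℚ._+_ (prefix-∑ n v _) (prefix-∑ n v _))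
                   (cong₂ ℚ._+_ (prefix-∑ n v _) (prefix-∑ n v _)) ⟩
  _ ∎
  where
  below : ℕ → Vector ℚ n
  below m j = [ toℕ j < m ]

-- Prefix sums of kernel vectors

-- The sequence lives on all of `ℕ` because `row` looks as far as index 3k + 4. `constant` governs
-- the overrun on the right, `start` the truncated index `i ∸ k` on the left.
record Solution (k : ℕ) (f : ℕ → ℚ) : Set where
  field
    start    : f 0 ≡ 0ℚ
    constant : ∀ m → 4 + (k + k) ≤ m → f m ≡ f (4 + (k + k))
    row      : ∀ i → i < 4 + (k + k) → f (suc i + k) ℚ.+ f (i ∸ k) ≡ f (suc i) ℚ.+ f i

kernel⇒solution : ∀ k v → InKernel (A (4 + (k + k)) k) v → Solution k (prefix v)
kernel⇒solution k v Av≡𝟎 = record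
  { start    = prefix-zero v
  ; constant = prefix-≥ v
  ; row      = λ i i<n → subst (λ i → prefix v (suc i + k) ℚ.+ prefix v (i ∸ k) ≡ prefix v (suc i) ℚ.+ prefix v i)
      (toℕ-fromℕ< i<n)
      (x∙y⁻¹≈ε⇒x≈y _ _ (trans (sym (A-row _ k v (fromℕ< i<n))) (Av≡𝟎 (fromℕ< i<n))))
  }

-- Taking differences forgets `f 0` and all values beyond n; `start` and `constant` restore them.
prefix-difference-solution : ∀ {k f} → Solution k f → prefix (difference {4 + (k + k)} f) ≗ f
prefix-difference-solution {k} {f} sol m with ≤-total m (4 + (k + k))
... | inj₁ m≤n = begin
  prefix (difference {4 + (k + k)} f) m             ≡⟨ prefix-difference f m m≤n ⟩
  f m ℚ.- f 0                                       ≡⟨ cong (λ x → f m ℚ.- x) (Solution.start sol) ⟩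
  f m ℚ.- 0ℚ                                        ≡⟨ ℚ.+-identityʳ (f m) ⟩
  f m                                               ∎
... | inj₂ n≤m = begin
  prefix (difference {4 + (k + k)} f) m             ≡⟨ prefix-≥ (difference {4 + (k + k)} f) m n≤m ⟩
  prefix (difference {4 + (k + k)} f) (4 + (k + k)) ≡⟨ prefix-difference f _ ≤-refl ⟩
  f (4 + (k + k)) ℚ.- f 0                           ≡⟨ cong₂ ℚ._-_ (sym (Solution.constant sol m n≤m)) (Solution.start sol) ⟩
  f m ℚ.- 0ℚ                                        ≡⟨ ℚ.+-identityʳ (f m) ⟩
  f m                                               ∎

solution⇒kernel : ∀ k {f} → Solution k f → InKernel (A (4 + (k + k)) k) (difference f)
solution⇒kernel k {f} sol i = begin
  (A (4 + (k + k)) k · difference f) i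
    ≡⟨ A-row _ k (difference f) i ⟩
  _
    ≡⟨ cong₂ ℚ._-_ (cong₂ ℚ._+_ (P≗f (suc (toℕ i) + k)) (P≗f (toℕ i ∸ k)))
                   (cong₂ ℚ._+_ (P≗f (suc (toℕ i))) (P≗f (toℕ i))) ⟩
  (f (suc (toℕ i) + k) ℚ.+ f (toℕ i ∸ k)) ℚ.- (f (suc (toℕ i)) ℚ.+ f (toℕ i))
    ≡⟨ x≈y⇒x∙y⁻¹≈ε (Solution.row sol (toℕ i) (toℕ<n i)) ⟩
  0ℚ ∎
  where
  P≗f : prefix (difference {4 + (k + k)} f) ≗ f
  P≗f = prefix-difference-solution sol

zero-solution : ∀ k → Solution k (λ _ → 0ℚ)
zero-solution k = record { start = refl ; constant = λ _ _ → refl ; row = λ _ _ → refl }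

-- The sequence of period three

periodic : ℚ → ℚ → ℕ → ℚ
periodic a t 0                   = t ℚ.- a
periodic a t 1                   = 0ℚ
periodic a t 2                   = a
periodic a t (suc (suc (suc m))) = periodic a t m

periodic-sum : ∀ a t m →
  periodic a t m ℚ.+ periodic a t (1 + m) ℚ.+ periodic a t (2 + m) ≡ t
periodic-sum a t 0 = identity a t
  where
  identity : ∀ a t → (t ℚ.- a) ℚ.+ 0ℚ ℚ.+ a ≡ t
  identity = solve-∀ ℚ-ring
periodic-sum a t 1 = identity a t
  where
  identity : ∀ a t → 0ℚ ℚ.+ a ℚ.+ (t ℚ.- a) ≡ t
  identity = solve-∀ ℚ-ring
periodic-sum a t 2 = identity a t
  where
  identity : ∀ a t → a ℚ.+ (t ℚ.- a) ℚ.+ 0ℚ ≡ t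
  identity = solve-∀ ℚ-ring
periodic-sum a t (suc (suc (suc m))) = periodic-sum a t m

periodic-+ : ∀ a t {k} → 3 ∣ k → ∀ m → periodic a t (m + k) ≡ periodic a t m
periodic-+ a t (divides q refl) m =
  trans (cong (periodic a t) (+-comm m (q * 3))) (multiple q)
  where
  multiple : ∀ q → periodic a t (q * 3 + m) ≡ periodic a t m
  multiple zero    = refl
  multiple (suc q) = multiple q

periodic-linear : ∀ a t m →
  periodic a t m ≡ a ℚ.* periodic 1ℚ 0ℚ m ℚ.+ t ℚ.* periodic 0ℚ 1ℚ m
periodic-linear a t 0 = identity a t
  where
  identity : ∀ a t → t ℚ.- a ≡ a ℚ.* (0ℚ ℚ.- 1ℚ) ℚ.+ t ℚ.* (1ℚ ℚ.- 0ℚ)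
  identity = solve-∀ ℚ-ring
periodic-linear a t 1 = identity a t
  where
  identity : ∀ a t → 0ℚ ≡ a ℚ.* 0ℚ ℚ.+ t ℚ.* 0ℚ
  identity = solve-∀ ℚ-ring
periodic-linear a t 2 = identity a t
  where
  identity : ∀ a t → a ≡ a ℚ.* 1ℚ ℚ.+ t ℚ.* 0ℚ
  identity = solve-∀ ℚ-ring
periodic-linear a t (suc (suc (suc m))) = periodic-linear a t m

-- Consequences of the kernel equations

module Properties (l : ℕ) {f} (sol : Solution (suc l) f) where
  open Solution sol

  private
    k : ℕ
    k = suc l

    a t : ℚ
    a = f 2
    t = f (4 + (k + k))

  low-row : ∀ i → i ≤ k → f (suc (i + k)) ≡ f (suc i) ℚ.+ f i
  low-row i i≤k = begin
    f (suc (i + k))                ≡⟨ ℚ.+-identityʳ _ ⟨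
    f (suc (i + k)) ℚ.+ 0ℚ         ≡⟨ cong (f (suc (i + k)) ℚ.+_) (trans (cong f (m≤n⇒m∸n≡0 i≤k)) start) ⟨
    f (suc i + k) ℚ.+ f (i ∸ k)    ≡⟨ row i (≤-<-trans i≤k (≤-trans (s≤s (m≤m+n k k)) (m≤n+m _ 3))) ⟩
    f (suc i) ℚ.+ f i              ∎

  -- This is row j + k, shifted so that the truncated subtraction is exact.
  far-row : ∀ j → j ≤ 3 + k → f (suc (j + k) + k) ℚ.+ f j ≡ f (suc (j + k)) ℚ.+ f (j + k)
  far-row j j≤3+k = subst (λ m → f (suc (j + k) + k) ℚ.+ f m ≡ f (suc (j + k)) ℚ.+ f (j + k))
    (m+n∸n≡m j k) (row (j + k) (s≤s (+-monoˡ-≤ k j≤3+k)))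

  -- In row j + k + 3 the largest index is at least n, where `f` has already reached `t`.
  high-row : ∀ j → j ≤ k → t ℚ.+ f (3 + j) ≡ f (4 + (j + k)) ℚ.+ f (3 + (j + k))
  high-row j j≤k = trans
    (cong (ℚ._+ f (3 + j)) (sym (constant (4 + (j + k) + k) (+-monoʳ-≤ 4 (+-monoˡ-≤ k (m≤n+m k j))))))
    (far-row (3 + j) (+-monoʳ-≤ 3 j≤k))

  -- The last row has `t` on both sides.
  f[3+k]≡f[3+2k] : f (3 + k) ≡ f (3 + (k + k))
  f[3+k]≡f[3+2k] = ∙-cancelˡ t _ _ (high-row k ≤-refl)

  -- Row k + 2, after cancelling the two values just identified.
  f[2+k]≡a : f (2 + k) ≡ a
  f[2+k]≡a = sym (∙-cancelˡ (f (3 + k)) _ _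
    (trans (cong (ℚ._+ a) f[3+k]≡f[3+2k]) (far-row 2 (m≤m+n 2 (suc k)))))

  -- Row 1 reads f (k + 2) = a + f 1; it is a low row because 1 ≤ k.
  f[1]≡0 : f 1 ≡ 0ℚ
  f[1]≡0 = identityʳ-unique a (f 1) (trans (sym (low-row 1 (s≤s z≤n))) f[2+k]≡a)

  f[1+k]≡0 : f (1 + k) ≡ 0ℚ
  f[1+k]≡0 = trans (low-row 0 z≤n) (cong₂ ℚ._+_ f[1]≡0 start)

  f[2+2k]≡a : f (2 + (k + k)) ≡ a
  f[2+2k]≡a = begin
    f (2 + (k + k))            ≡⟨ ℚ.+-identityʳ _ ⟨
    f (2 + (k + k)) ℚ.+ 0ℚ     ≡⟨ cong (f (2 + (k + k)) ℚ.+_) f[1]≡0 ⟨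
    f (2 + (k + k)) ℚ.+ f 1    ≡⟨ far-row 1 (s≤s z≤n) ⟩
    f (2 + k) ℚ.+ f (1 + k)    ≡⟨ cong₂ ℚ._+_ f[2+k]≡a f[1+k]≡0 ⟩
    a ℚ.+ 0ℚ                   ≡⟨ ℚ.+-identityʳ a ⟩
    a                          ∎

  -- The last row but one, where f (k + 2) and f (2k + 2) are both `a` and cancel.
  f[3+2k]≡t : f (3 + (k + k)) ≡ t
  f[3+2k]≡t = sym (∙-cancelʳ a _ _ (begin
    t ℚ.+ a                                ≡⟨ cong (t ℚ.+_) f[2+k]≡a ⟨
    t ℚ.+ f (2 + k)                        ≡⟨ high-row l (n≤1+n l) ⟩
    f (3 + (k + k)) ℚ.+ f (2 + (k + k))    ≡⟨ cong (f (3 + (k + k)) ℚ.+_) f[2+2k]≡a ⟩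
    f (3 + (k + k)) ℚ.+ a                  ∎))

  -- The first instance is row 2. Each later one comes from a high row: two low rows rewrite its
  -- right side in terms of f (j + 2), f (j + 3) and f (j + 4), and one f (j + 3) cancels.
  three-term : ∀ j → 2 + j ≤ k → f (1 + j) ℚ.+ f (2 + j) ℚ.+ f (3 + j) ≡ t
  three-term zero 2≤k = begin
    f 1 ℚ.+ f 2 ℚ.+ f 3  ≡⟨ cong (λ x → x ℚ.+ f 2 ℚ.+ f 3) f[1]≡0 ⟩
    0ℚ ℚ.+ f 2 ℚ.+ f 3   ≡⟨ cong (ℚ._+ f 3) (ℚ.+-identityˡ (f 2)) ⟩
    f 2 ℚ.+ f 3          ≡⟨ ℚ.+-comm (f 2) (f 3) ⟩
    f 3 ℚ.+ f 2          ≡⟨ low-row 2 2≤k ⟨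
    f (3 + k)            ≡⟨ f[3+k]≡f[3+2k] ⟩
    f (3 + (k + k))      ≡⟨ f[3+2k]≡t ⟩
    t                    ∎
  three-term (suc j) 3+j≤k = sym (∙-cancelʳ (f (3 + j)) _ _ (begin
    t ℚ.+ f (3 + j)
      ≡⟨ high-row j (≤-trans (m≤n+m j 3) 3+j≤k) ⟩
    f (4 + (j + k)) ℚ.+ f (3 + (j + k))
      ≡⟨ cong₂ ℚ._+_ (low-row (3 + j) 3+j≤k) (low-row (2 + j) (≤-trans (n≤1+n _) 3+j≤k)) ⟩
    (f (4 + j) ℚ.+ f (3 + j)) ℚ.+ (f (3 + j) ℚ.+ f (2 + j))
      ≡⟨ identity (f (2 + j)) (f (3 + j)) (f (4 + j)) ⟩
    (f (2 + j) ℚ.+ f (3 + j) ℚ.+ f (4 + j)) ℚ.+ f (3 + j) ∎))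
    where
    identity : ∀ x y z → (z ℚ.+ y) ℚ.+ (y ℚ.+ x) ≡ (x ℚ.+ y ℚ.+ z) ℚ.+ y
    identity = solve-∀ ℚ-ring

  -- Agreement begins at index 1 only: `periodic a t 0` is t - a, as the period demands, whereas
  -- `f 0` is 0.
  low-periodic : ∀ m → m ≤ k → f (1 + m) ≡ periodic a t (1 + m)
  low-periodic 0             _     = f[1]≡0
  low-periodic 1             _     = refl
  low-periodic (suc (suc m)) 2+m≤k = ∙-cancelˡ (f (1 + m) ℚ.+ f (2 + m)) _ _ (begin
    f (1 + m) ℚ.+ f (2 + m) ℚ.+ f (3 + m)
      ≡⟨ three-term m 2+m≤k ⟩
    t
      ≡⟨ periodic-sum a t (1 + m) ⟨
    periodic a t (1 + m) ℚ.+ periodic a t (2 + m) ℚ.+ periodic a t (3 + m)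
      ≡⟨ cong (ℚ._+ periodic a t (3 + m))
           (cong₂ ℚ._+_ (low-periodic m (≤-trans (m≤n+m m 2) 2+m≤k))
                        (low-periodic (suc m) (≤-trans (n≤1+n _) 2+m≤k))) ⟨
    f (1 + m) ℚ.+ f (2 + m) ℚ.+ periodic a t (3 + m) ∎)

  t≡a+f[k] : t ≡ a ℚ.+ f k
  t≡a+f[k] = by-size l refl
    where
    by-size : ∀ m → m ≡ l → t ≡ a ℚ.+ f k
    -- For k = 1 row 2k + 1 does not reach past the end, but then k + 3 and 2k + 2 are the same
    -- index, which forces t = a.
    by-size 0 refl = begin
      t            ≡⟨ f[3+2k]≡t ⟨
      f 5          ≡⟨ f[3+k]≡f[3+2k] ⟨
      f 4          ≡⟨ f[2+2k]≡a ⟩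
      a            ≡⟨ ℚ.+-identityʳ a ⟨
      a ℚ.+ 0ℚ     ≡⟨ cong (a ℚ.+_) f[1]≡0 ⟨
      a ℚ.+ f 1    ∎
    -- Here k = m + 2, and `high-row m` is row 2k + 1.
    by-size (suc m) refl = begin
      t                                   ≡⟨ ℚ.+-identityʳ t ⟨
      t ℚ.+ 0ℚ                            ≡⟨ cong (t ℚ.+_) f[1+k]≡0 ⟨
      t ℚ.+ f (1 + k)                     ≡⟨ high-row m (m≤n+m m 2) ⟩
      f (2 + (k + k)) ℚ.+ f (1 + (k + k)) ≡⟨ cong₂ ℚ._+_ f[2+2k]≡a (low-row k ≤-refl) ⟩
      a ℚ.+ (f (1 + k) ℚ.+ f k)           ≡⟨ cong (λ x → a ℚ.+ (x ℚ.+ f k)) f[1+k]≡0 ⟩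
      a ℚ.+ (0ℚ ℚ.+ f k)                  ≡⟨ cong (a ℚ.+_) (ℚ.+-identityˡ (f k)) ⟩
      a ℚ.+ f k                           ∎

-- Dependence of a solution on two parameters

data Index (k : ℕ) : ℕ → Set where
  origin : Index k 0
  low    : ∀ m → m ≤ k → Index k (suc m)
  middle : ∀ i → 1 ≤ i → i ≤ k → Index k (suc (i + k))
  first  : Index k (2 + (k + k))
  second : Index k (3 + (k + k))
  high   : ∀ m → 4 + (k + k) ≤ m → Index k m

index : ∀ k m → Index k m
index k zero = origin
index k (suc m) with m ≤? k
... | yes m≤k = low m m≤k
... | no  m≰k with m ∸ k | m∸n+n≡m (<⇒≤ (≰⇒> m≰k)) | m<n⇒0<n∸m (≰⇒> m≰k)
...   | i | refl | 1≤i with <-cmp i (suc k)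
...     | tri< (s≤s i≤k) _ _ = middle i 1≤i i≤k
...     | tri≈ _ refl _      = first
...     | tri> _ _ 2+k≤i with <-cmp i (2 + k)
...       | tri< (s≤s i≤1+k) _ _ = contradiction 2+k≤i (≤⇒≯ i≤1+k)
...       | tri≈ _ refl _        = second
...       | tri> _ _ 3+k≤i       = high _ (s≤s (+-monoˡ-≤ k 3+k≤i))

-- Each class of `Index` has its own determining equation: the period on `low`, the low rows on
-- `middle`, the values `a` and `t` at `first` and `second`, constancy on `high`.
solution-unique : ∀ l {f g} → let k = suc l in Solution k f → Solution k g →
  f 2 ≡ g 2 → f (4 + (k + k)) ≡ g (4 + (k + k)) → f ≗ g
solution-unique l {f} {g} F G f₂≡g₂ fₙ≡gₙ m = by-index (index k m)
  where
  k = suc l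
  module F = Properties l F
  module G = Properties l G

  low-equal : ∀ m → m ≤ k → f (suc m) ≡ g (suc m)
  low-equal m m≤k = begin
    f (suc m)                                   ≡⟨ F.low-periodic m m≤k ⟩
    periodic (f 2) (f (4 + (k + k))) (suc m)    ≡⟨ cong₂ (λ a t → periodic a t (suc m)) f₂≡g₂ fₙ≡gₙ ⟩
    periodic (g 2) (g (4 + (k + k))) (suc m)    ≡⟨ G.low-periodic m m≤k ⟨
    g (suc m)                                   ∎

  by-index : ∀ {m} → Index k m → f m ≡ g m
  by-index origin       = trans (Solution.start F) (sym (Solution.start G))
  by-index (low m m≤k)  = low-equal m m≤k
  by-index (middle (suc i) _ 1+i≤k) = begin
    f (suc (suc i + k))            ≡⟨ F.low-row (suc i) 1+i≤k ⟩
    f (2 + i) ℚ.+ f (1 + i)        ≡⟨ cong₂ ℚ._+_ (low-equal (suc i) 1+i≤k) (low-equal i (<⇒≤ 1+i≤k)) ⟩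
    g (2 + i) ℚ.+ g (1 + i)        ≡⟨ G.low-row (suc i) 1+i≤k ⟨
    g (suc (suc i + k))            ∎
  by-index first        = trans F.f[2+2k]≡a (trans f₂≡g₂ (sym G.f[2+2k]≡a))
  by-index second       = trans F.f[3+2k]≡t (trans fₙ≡gₙ (sym G.f[3+2k]≡t))
  by-index (high m n≤m) = trans (Solution.constant F m n≤m) (trans fₙ≡gₙ (sym (Solution.constant G m n≤m)))

-- Descending by threes leaves the residues 1 and 2. Residue 1 gives a = 0 and t = a; residue 2
-- gives t = a and t = a + a.
periodic-forced : ∀ a t k → 3 ∤ k →
  periodic a t (1 + k) ≡ 0ℚ → t ≡ a ℚ.+ periodic a t k → a ≡ 0ℚ × t ≡ 0ℚ
periodic-forced a t 0 3∤0 _ _ = contradiction (divides 0 refl) 3∤0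
periodic-forced a t 1 _ a≡0 t≡a+0 = a≡0 , trans t≡a+0 (trans (ℚ.+-identityʳ a) a≡0)
periodic-forced a t 2 _ t-a≡0 t≡a+a = a≡0 , trans t≡a a≡0
  where
  t≡a : t ≡ a
  t≡a = x∙y⁻¹≈ε⇒x≈y t a t-a≡0

  a≡0 : a ≡ 0ℚ
  a≡0 = identityʳ-unique a a (trans (sym t≡a+a) t≡a)
periodic-forced a t (suc (suc (suc k))) 3∤3+k =
  periodic-forced a t k (λ 3∣k → 3∤3+k (∣m∣n⇒∣m+n ∣-refl 3∣k))

solution-zero : ∀ l {f} → 3 ∤ suc l → Solution (suc l) f → ∀ m → f m ≡ 0ℚ
solution-zero l {f} 3∤k F = solution-unique l F (zero-solution k) (proj₁ a≡0×t≡0) (proj₂ a≡0×t≡0)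
  where
  k = suc l
  open Properties l F

  a≡0×t≡0 : f 2 ≡ 0ℚ × f (4 + (k + k)) ≡ 0ℚ
  a≡0×t≡0 = periodic-forced _ _ k 3∤k
    (trans (sym (low-periodic k ≤-refl)) f[1+k]≡0)
    (trans t≡a+f[k] (cong (f 2 ℚ.+_) (low-periodic l (n≤1+n l))))

-- The two-parameter family of solutions for 3 ∣ k

-- On 1 … k + 1 the solution is the periodic sequence p; on k + 2 … 2k + 3 the low
-- rows force p (i + 1) + p i = t − p (i + 2) at index m = i + k + 1, and since 3 ∣ k
-- this is t − p (m + 1).
σ : ℕ → ℚ → ℚ → ℕ → ℚ
σ k a t zero    = 0ℚ
σ k a t (suc m) with m ≤? k | m ≤? 2 + (k + k)
... | yes _ | _     = periodic a t (suc m)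
... | no  _ | yes _ = t ℚ.- periodic a t (2 + m)
... | no  _ | no  _ = t

-- Linearity in the parameters makes the members at (1, 0) and (0, 1) generate the family.
σ-linear : ∀ k a t m → σ k a t m ≡ a ℚ.* σ k 1ℚ 0ℚ m ℚ.+ t ℚ.* σ k 0ℚ 1ℚ m
σ-linear k a t zero = identity a t
  where
  identity : ∀ a t → 0ℚ ≡ a ℚ.* 0ℚ ℚ.+ t ℚ.* 0ℚ
  identity = solve-∀ ℚ-ring
σ-linear k a t (suc m) with m ≤? k | m ≤? 2 + (k + k)
... | yes _ | _     = periodic-linear a t (suc m)
... | no  _ | yes _ = trans (cong (λ x → t ℚ.- x) (periodic-linear a t (2 + m)))
                            (identity a t (periodic 1ℚ 0ℚ (2 + m)) (periodic 0ℚ 1ℚ (2 + m)))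
  where
  identity : ∀ a t x y → t ℚ.- (a ℚ.* x ℚ.+ t ℚ.* y) ≡ a ℚ.* (0ℚ ℚ.- x) ℚ.+ t ℚ.* (1ℚ ℚ.- y)
  identity = solve-∀ ℚ-ring
... | no  _ | no  _ = identity a t
  where
  identity : ∀ a t → t ≡ a ℚ.* 0ℚ ℚ.+ t ℚ.* 1ℚ
  identity = solve-∀ ℚ-ring

σ-low : ∀ k a t m → m ≤ k → σ k a t (suc m) ≡ periodic a t (suc m)
σ-low k a t m m≤k with m ≤? k | m ≤? 2 + (k + k)
... | yes _   | _ = refl
... | no  m≰k | _ = contradiction m≤k m≰k

-- The bound `2 + k` goes two beyond the low rows, so the same formula also serves the indices 2k +
-- 2 and 2k + 3.
σ-middle : ∀ {k} a t → 3 ∣ k → ∀ i → 1 ≤ i → i ≤ 2 + k →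
  σ k a t (suc (i + k)) ≡ t ℚ.- periodic a t (2 + i)
σ-middle {k} a t 3∣k i 1≤i i≤2+k with i + k ≤? k | i + k ≤? 2 + (k + k)
... | yes i+k≤k | _            = contradiction i+k≤k (<⇒≱ (+-monoˡ-≤ k 1≤i))
... | no  _     | yes _        = cong (λ x → t ℚ.- x) (periodic-+ a t 3∣k (2 + i))
... | no  _     | no  i+k≰2+2k = contradiction (+-monoˡ-≤ k i≤2+k) i+k≰2+2k

σ-high : ∀ k a t m → 4 + (k + k) ≤ m → σ k a t m ≡ t
σ-high k a t (suc m) (s≤s 3+2k≤m) with m ≤? k | m ≤? 2 + (k + k)
... | yes m≤k | _          = contradiction m≤k (<⇒≱ (≤-trans (s≤s (≤-trans (m≤m+n k k) (m≤n+m _ 2))) 3+2k≤m))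
... | no  _   | yes m≤2+2k = contradiction m≤2+2k (<⇒≱ 3+2k≤m)
... | no  _   | no  _      = refl

σ-far-row : ∀ {k} a t → 1 ≤ k → 3 ∣ k → ∀ j → 1 ≤ j → j ≤ 3 + k → let f = σ k a t in
  f (suc (j + k) + k) ℚ.+ f j ≡ f (suc (j + k)) ℚ.+ f (j + k)
σ-far-row {k} a t 1≤k 3∣k = λ
  { 1 _ _ → begin
      f (2 + (k + k)) ℚ.+ f 1                ≡⟨ cong₂ ℚ._+_ (middle-k 1 (s≤s z≤n)) (σ-low k a t 0 z≤n) ⟩
      (t ℚ.- p 3) ℚ.+ p 1                    ≡⟨ cong₂ ℚ._+_ (middle-1 1 (s≤s z≤n) (s≤s z≤n)) f[1+k]≡p[1] ⟨
      f (2 + k) ℚ.+ f (1 + k)                ∎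
  ; 2 _ _ → begin
      f (3 + (k + k)) ℚ.+ f 2                ≡⟨ cong₂ ℚ._+_ (middle-k 2 ≤-refl) (σ-low k a t 1 1≤k) ⟩
      -- `p 4` computes to `0ℚ` and `p 3` to `t ℚ.- a`.
      (t ℚ.- 0ℚ) ℚ.+ a                       ≡⟨ identity₂ a t ⟩
      (t ℚ.- 0ℚ) ℚ.+ (t ℚ.- (t ℚ.- a))       ≡⟨ cong₂ ℚ._+_ (middle-1 2 (s≤s z≤n) (s≤s (s≤s z≤n))) (middle-1 1 (s≤s z≤n) (s≤s z≤n)) ⟨
      f (3 + k) ℚ.+ f (2 + k)                ∎
  ; (suc (suc (suc j))) _ (s≤s (s≤s (s≤s j≤k))) → trans
      (cong (ℚ._+ f (3 + j)) (σ-high k a t _ (+-monoʳ-≤ 4 (+-monoˡ-≤ k (m≤n+m k j)))))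
      (last-row j j≤k)
  }
  where
  f p : ℕ → ℚ
  f = σ k a t
  p = periodic a t

  middle-1 : ∀ i → 1 ≤ i → i ≤ 2 + k → f (suc (i + k)) ≡ t ℚ.- p (2 + i)
  middle-1 = σ-middle a t 3∣k

  middle-k : ∀ i → i ≤ 2 → f (suc (i + k + k)) ≡ t ℚ.- p (2 + i)
  middle-k i i≤2 = trans
    (middle-1 (i + k) (≤-trans 1≤k (m≤n+m k i)) (+-monoˡ-≤ k i≤2))
    (cong (λ x → t ℚ.- x) (periodic-+ a t 3∣k (2 + i)))

  f[1+k]≡p[1] : f (1 + k) ≡ p 1
  f[1+k]≡p[1] = trans (σ-low k a t k ≤-refl) (periodic-+ a t 3∣k 1)

  identity₂ : ∀ a t → (t ℚ.- 0ℚ) ℚ.+ a ≡ (t ℚ.- 0ℚ) ℚ.+ (t ℚ.- (t ℚ.- a))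
  identity₂ = solve-∀ ℚ-ring

  -- The ring solver takes no hypotheses, so the sum of three consecutive terms stands in for `t`
  -- here, and `subst` along `periodic-sum` replaces it afterwards.
  identity₃ : ∀ x y z → let t = x ℚ.+ y ℚ.+ z in t ℚ.+ x ≡ (t ℚ.- z) ℚ.+ (t ℚ.- y)
  identity₃ = solve-∀ ℚ-ring

  identity₄ : ∀ t x → t ℚ.+ x ≡ (t ℚ.- 0ℚ) ℚ.+ x
  identity₄ = solve-∀ ℚ-ring

  last-row : ∀ j → j ≤ k → t ℚ.+ f (3 + j) ≡ f (4 + (j + k)) ℚ.+ f (3 + (j + k))
  -- As long as j + 2 ≤ k, index j + 3 lies on the low stretch. The exceptions are j = k and j + 1 =
  -- k, where it has moved into the middle stretch.
  last-row j j≤k with ≤-<-connex (2 + j) k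
  ... | inj₁ 2+j≤k = begin
    t ℚ.+ f (3 + j)                           ≡⟨ cong (t ℚ.+_) (σ-low k a t (2 + j) 2+j≤k) ⟩
    t ℚ.+ p j                                 ≡⟨ subst (λ t → t ℚ.+ p j ≡ (t ℚ.- p (2 + j)) ℚ.+ (t ℚ.- p (1 + j)))
                                                       (periodic-sum a t j) (identity₃ (p j) (p (1 + j)) (p (2 + j))) ⟩
    (t ℚ.- p (2 + j)) ℚ.+ (t ℚ.- p (1 + j))   ≡⟨ cong₂ ℚ._+_ (middle-1 (3 + j) (s≤s z≤n) (s≤s (≤-trans 2+j≤k (n≤1+n k))))
                                                             (middle-1 (2 + j) (s≤s z≤n) (+-monoʳ-≤ 2 j≤k)) ⟨
    f (4 + (j + k)) ℚ.+ f (3 + (j + k))       ∎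
  ... | inj₂ k<2+j with <-cmp j k
  ...   | tri> _ _ k<j = contradiction j≤k (<⇒≱ k<j)
  ...   | tri≈ _ refl _ = cong₂ ℚ._+_ (sym (σ-high k a t _ ≤-refl)) (trans (middle-1 2 (s≤s z≤n) (s≤s (s≤s z≤n))) (sym (middle-k 2 ≤-refl)))
  ...   | tri< 1+j≤k _ _ with ≤-antisym 1+j≤k (≤-pred k<2+j)
  ...     | refl = begin
    t ℚ.+ f (2 + k)                           ≡⟨ cong (t ℚ.+_) (middle-1 1 (s≤s z≤n) (s≤s z≤n)) ⟩
    t ℚ.+ (t ℚ.- p 3)                         ≡⟨ identity₄ t (t ℚ.- p 3) ⟩
    (t ℚ.- 0ℚ) ℚ.+ (t ℚ.- p 3)                ≡⟨ cong₂ ℚ._+_ (middle-k 2 ≤-refl) (middle-k 1 (s≤s z≤n)) ⟨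
    f (3 + (k + k)) ℚ.+ f (2 + (k + k))       ∎

σ-solution : ∀ {k} a t → 1 ≤ k → 3 ∣ k → Solution k (σ k a t)
σ-solution {k} a t 1≤k 3∣k = record
  { start    = refl
  ; constant = λ m n≤m → trans (σ-high k a t m n≤m) (sym (σ-high k a t _ ≤-refl))
  ; row      = σ-row
  }
  where
  f p : ℕ → ℚ
  f = σ k a t
  p = periodic a t

  identity : ∀ x y z → ((x ℚ.+ y ℚ.+ z) ℚ.- z) ℚ.+ 0ℚ ≡ y ℚ.+ x
  identity = solve-∀ ℚ-ring

  σ-row : ∀ i → i < 4 + (k + k) → f (suc i + k) ℚ.+ f (i ∸ k) ≡ f (suc i) ℚ.+ f i
  σ-row i (s≤s i≤3+2k) with ≤-<-connex i k
  ... | inj₂ k<i = subst (λ m → f (suc m + k) ℚ.+ f (i ∸ k) ≡ f (suc m) ℚ.+ f m)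
    (m∸n+n≡m (<⇒≤ k<i))
    (σ-far-row a t 1≤k 3∣k (i ∸ k) (m<n⇒0<n∸m k<i)
      (m≤n+o⇒m∸n≤o i k (subst (i ≤_) (+-comm (3 + k) k) i≤3+2k)))
  ... | inj₁ i≤k rewrite m≤n⇒m∸n≡0 i≤k = low-case i i≤k
    where
    low-case : ∀ i → i ≤ k → f (suc i + k) ℚ.+ 0ℚ ≡ f (suc i) ℚ.+ f i
    -- `f 0` is `0ℚ` by definition. Index k + 1 still belongs to the low stretch, hence the separate
    -- case.
    low-case zero    _     = cong (ℚ._+ 0ℚ) (begin
      f (1 + k)    ≡⟨ σ-low k a t k ≤-refl ⟩
      p (1 + k)    ≡⟨ periodic-+ a t 3∣k 1 ⟩
      p 1          ≡⟨ σ-low k a t 0 z≤n ⟨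
      f 1          ∎)
    low-case (suc i) 1+i≤k = begin
      f (2 + i + k) ℚ.+ 0ℚ
        ≡⟨ cong (ℚ._+ 0ℚ) (σ-middle a t 3∣k (suc i) (s≤s z≤n) (≤-trans 1+i≤k (m≤n+m k 2))) ⟩
      (t ℚ.- p (3 + i)) ℚ.+ 0ℚ
        ≡⟨ subst (λ t → (t ℚ.- p (3 + i)) ℚ.+ 0ℚ ≡ p (2 + i) ℚ.+ p (1 + i))
             (periodic-sum a t (1 + i)) (identity (p (1 + i)) (p (2 + i)) (p (3 + i))) ⟩
      p (2 + i) ℚ.+ p (1 + i)
        ≡⟨ cong₂ ℚ._+_ (σ-low k a t (suc i) 1+i≤k) (σ-low k a t i (<⇒≤ 1+i≤k)) ⟨
      f (2 + i) ℚ.+ f (1 + i) ∎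

-- The nullity in the two cases

nullity-divisible : ∀ l → 3 ∣ suc l → let k = suc l in N⟨ 4 + (k + k) , k ⟩≡ 2
nullity-divisible l 3∣k = basis , record
  { inKernel    = λ { zero → solution⇒kernel k (σ-sol 1ℚ 0ℚ) ; (suc zero) → solution⇒kernel k (σ-sol 0ℚ 1ℚ) }
  ; independent = λ c c·b≗𝟎 →
      let σ≗0 : ∀ m → σ k (c zero) (c (suc zero)) m ≡ 0ℚ
          σ≗0 m = trans (sym (prefix-difference-solution (σ-sol _ _) m))
                        (prefix-𝟎 (λ j → trans (sym (linComb-basis c j)) (c·b≗𝟎 j)) m)
      -- The parameters are read off as the values at the indices 2 and n; index 2 is on the low
      -- stretch because 1 ≤ k.
      in λ { zero       → trans (sym (σ-low k (c zero) (c (suc zero)) 1 (s≤s z≤n))) (σ≗0 2)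
           ; (suc zero) → trans (sym (σ-high k _ _ n ≤-refl)) (σ≗0 n) }
  ; spanning    = λ v Av≗𝟎 → coordinates v , λ j → begin
      v j                                                      ≡⟨ difference-prefix v j ⟨
      difference (prefix v) j                                  ≡⟨ cong₂ ℚ._-_ (prefix≗σ v Av≗𝟎 (suc (toℕ j))) (prefix≗σ v Av≗𝟎 (toℕ j)) ⟩
      difference (σ k (prefix v 2) (prefix v n)) j             ≡⟨ linComb-basis (coordinates v) j ⟨
      linComb (coordinates v) basis j                          ∎
  }
  where
  k n : ℕ
  k = suc l
  n = 4 + (k + k)

  σ-sol : ∀ a t → Solution k (σ k a t)
  σ-sol a t = σ-solution a t (s≤s z≤n) 3∣k

  basis : Fin 2 → Vector ℚ n
  basis zero       = difference (σ k 1ℚ 0ℚ)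
  basis (suc zero) = difference (σ k 0ℚ 1ℚ)

  coordinates : Vector ℚ n → Vector ℚ 2
  coordinates v zero       = prefix v 2
  coordinates v (suc zero) = prefix v n

  linComb-basis : ∀ c → linComb c basis ≗ difference (σ k (c zero) (c (suc zero)))
  linComb-basis c j = trans
    (identity (c zero) (c (suc zero)) _ _ _ _)
    (sym (cong₂ ℚ._-_ (σ-linear k _ _ (suc (toℕ j))) (σ-linear k _ _ (toℕ j))))
    where
    identity : ∀ a t x x′ y y′ →
      a ℚ.* (x′ ℚ.- x) ℚ.+ (t ℚ.* (y′ ℚ.- y) ℚ.+ 0ℚ) ≡ (a ℚ.* x′ ℚ.+ t ℚ.* y′) ℚ.- (a ℚ.* x ℚ.+ t ℚ.* y)
    identity = solve-∀ ℚ-ring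

  -- The member of the family with the same values at 2 and n must be the prefix sums themselves, by
  -- uniqueness.
  prefix≗σ : ∀ v → InKernel (A n k) v → prefix v ≗ σ k (prefix v 2) (prefix v n)
  prefix≗σ v Av≗𝟎 = solution-unique l (kernel⇒solution k v Av≗𝟎) (σ-sol _ _)
    (sym (σ-low k (prefix v 2) (prefix v n) 1 (s≤s z≤n))) (sym (σ-high k (prefix v 2) (prefix v n) n ≤-refl))

nullity-nondivisible : ∀ l → 3 ∤ suc l → let k = suc l in N⟨ 4 + (k + k) , k ⟩≡ 0
-- The basis is empty: all prefix sums of a kernel vector vanish, and with them its entries.
nullity-nondivisible l 3∤k = (λ ()) , record
  { inKernel    = λ ()
  ; independent = λ _ _ ()
  ; spanning    = λ v Av≗𝟎 →
      let prefix≗0 = solution-zero l 3∤k (kernel⇒solution (suc l) v Av≗𝟎)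
      in (λ ()) , λ j → trans (sym (difference-prefix v j))
                              (cong₂ ℚ._-_ (prefix≗0 (suc (toℕ j))) (prefix≗0 (toℕ j)))
  }

theorem8p4 : (k : ℕ) → 1 ≤ k →
    (3 ∣ k → N⟨ 2 * k + 4 , k ⟩≡ 2) × (3 ∤ k → N⟨ 2 * k + 4 , k ⟩≡ 0)
theorem8p4 (suc l) _ =
    (λ 3∣k → subst (N⟨_, suc l ⟩≡ 2) (size (suc l)) (nullity-divisible l 3∣k))
  , (λ 3∤k → subst (N⟨_, suc l ⟩≡ 0) (size (suc l)) (nullity-nondivisible l 3∤k))
  where
  size : ∀ k → 4 + (k + k) ≡ 2 * k + 4
  size = ℕ-solve-∀
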